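{- Let $n\ge1$, $k\ge1$, $l\in\{0,\dots,2n\}$, and let $t_1,\dots,t_k$ be positive even integers with $t=t_1+\dots+t_k\in\{1,\dots,n\}$, $2\le t\le\min\{l,2n-l\}$ and $l-t$ even. Let $$\mathbf a=\bigoplus_{i=1}^k\mathbf A_i\in SpT_{2n}(\varpi_t),\qquad \mathbf A_i=(a_i,a_i+1,\dots,a_i+t_i-1),\quad a_i\text{ odd}\quad(1\le i\le k).$$ Then $a_i\ge2(t_1+\dots+t_{i-1})+t_i+1$ for $1\le i\le k$. Moreover, define recursively, for $i=1,\dots,k$, $$l_i=\min\Big(\Big\{\big(a_j-2\sum_{m=1}^{j-1}t_m-t_j-1\big)-\sum_{m=1}^{i-1}l_m:\ i\le j\le k\Big\}\cup\Big\{l-t-\sum_{m=1}^{i-1}l_m\Big\}\Big),$$ and $l_{t+1}=l-t-\sum_{i=1}^kl_i$. Then $l_1,\dots,l_k,l_{t+1}$ are nonnegative even numbers, and the concatenation $$T=(1,\dots,l_1)\,\mathbf A_1\,(a_1+t_1,\dots,a_1+t_1-1+l_2)\,\mathbf A_2\,(a_2+t_2,\dots,a_2+t_2-1+l_3)\cdots\mathbf A_{k-1}\,(a_{k-1}+t_{k-1},\dots,a_{k-1}+t_{k-1}-1+l_k)\,\mathbf A_k\,(a_k+t_k,\dots,a_k+t_k-1+l_{t+1})$$ (each inserted interval having the indicated even length $l_1,l_2,\dots,l_k,l_{t+1}$, and being empty if that length is $0$) is an element of $SST_{2n}(\varpi_l)$ with $\mathrm{red}(T)=\mathbf a$; that is,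 $T=\mathrm{red}_t^{ -1}(\mathbf a)$ is the unique preimage of $\mathbf a$ in $SST_{2n}(\varpi_l)$ under the reduction map.
   Context: $SST_{2n}(\varpi_l)$ is the set of columns of length $l$ on the alphabet $\{1,\dots,2n\}$, i.e. strictly increasing sequences $(b_1<\dots<b_l)$ with entries in $\{1,\dots,2n\}$, often identified with the set of entries. $SpT_{2n}(\varpi_t)\subseteq SST_{2n}(\varpi_t)$ is the subset of symplectic columns: $b_k\ge2k-1$ for all $k$. The notation $\mathbf a=\bigoplus_{i=1}^k\mathbf A_i$ means that $\mathbf a$ is the disjoint union of the intervals $\mathbf A_i=(a_i,a_i+1,\dots,a_i+t_i-1)$ with $a_i$ odd, $t_i\ge2$ even, and $a_{i+1}-a_i\ge t_i+2$ for $1\le i\le k-1$. For a column $\mathbf b=(b_1,\dots,b_l)$ the removal subword $\mathrm{rem}(\mathbf b)$ is defined recursively: $\mathrm{rem}(\mathbf b)=\emptyset$ if $l\le1$; if $l\ge2$, $b_l$ is even, $b_{l-1}=b_l-1$ and $b_l<2l-|\mathrm{rem}(b_1,\dots,b_{l-2})|-1$, then $\mathrm{rem}(\mathbf b)=\mathrm{rem}(b_1,\dots,b_{l-2})\cup\{b_{l-1},b_l\}$; otherwise $\mathrm{rem}(\mathbf b)=\mathrm{rem}(b_1,\dots,b_{l-1})$. The reduction of $\mathbf b$ is $\mathrm{red}(\mathbf b)=\mathbf b\setminus\mathrm{rem}(\mathbf b)$. It is known (Watanabe) that $\mathrm{red}$ is injective on $SST_{2n}(\varpi_l)$ and takes values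 in $\bigsqcup_t SpT_{2n}(\varpi_t)$ over $0\le t\le\min\{l,2n-l\}$, $l-t$ even; $\mathrm{red}_t^{ -1}(\mathbf a)=T$ means $T\in SST_{2n}(\varpi_l)$ and $\mathrm{red}(T)=\mathbf a$. -}

module Defs where

open import Algebra.Properties.Monoid.Sum using (sum)
open import Data.Bool using (if_then_else_)
open import Data.Fin using (Fin; zero; suc; Fin′; inject; toℕ; fromℕ)
open import Data.Integer as ℤ using (ℤ; +_; -[1+_]; 0ℤ; 1ℤ)
open import Data.Integer.Properties as ℤ using ()
open import Data.List using (List; []; _∷_; _++_; applyUpTo; concat; filter; length; lookup; reverse; tabulate)
open import Data.List.Relation.Unary.All using (All)
open import Data.List.Relation.Unary.Linked using (Linked)
open import Data.Nat using (ℕ; suc; _+_; _*_; _≤_; _<_; _≟_; _<?_)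
open import Data.List.Membership.DecPropositional _≟_ using (_∈?_)
open import Data.Nat.Divisibility using (_∣_; _∣?_)
open import Data.Nat.Properties using (+-0-monoid)
open import Data.Product using (_×_)
open import Data.Vec.Functional using (Vector; foldr; tail; insertAt)
open import Relation.Binary.PropositionalEquality using (_≡_)
open import Relation.Nullary using (¬_; ¬?; does; _×-dec_)

sumℕ : ∀ {k} → Vector ℕ k → ℕ
sumℕ = sum +-0-monoid

sumℤ : ∀ {k} → Vector ℤ k → ℤ
sumℤ = sum ℤ.+-0-monoid

-- t₁ + ⋯ + tᵢ₋₁
sumBefore : ∀ {k} → Vector ℕ k → Fin k → ℕ
sumBefore t i = sumℕ (λ (m : Fin′ i) → t (inject m))

-- A column (b₁ < ⋯ < bₗ) is the list b₁ ∷ ⋯ ∷ bₗ ∷ [].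
record SST (n l : ℕ) (b : List ℕ) : Set where
  field
    length≡  : length b ≡ l
    strict   : Linked _<_ b
    entries  : All (λ x → 1 ≤ x × x ≤ 2 * n) b

-- Positions are counted from 0, so bₖ ≥ 2k − 1 reads 2i + 1 ≤ b i with k = i + 1.
record SpT (n t : ℕ) (b : List ℕ) : Set where
  field
    column      : SST n t b
    symplectic  : ∀ (i : Fin (length b)) → 2 * toℕ i + 1 ≤ lookup b i

-- rem for a column listed from its last entry to its first.  The condition
-- bₗ < 2l − |rem (b₁, …, bₗ₋₂)| − 1 is written without subtraction.
remʳ : List ℕ → List ℕ
remʳ []            = []
remʳ (_ ∷ [])      = []
remʳ (x ∷ y ∷ bs)  =
  if does ((2 ∣? x) ×-dec (y + 1 ≟ x)
           ×-dec (x + length (remʳ bs) + 1 <? 2 * length (x ∷ y ∷ bs)))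
  then x ∷ y ∷ remʳ bs
  else remʳ (y ∷ bs)

rem : List ℕ → List ℕ
rem b = reverse (remʳ (reverse b))

red : List ℕ → List ℕ
red b = filter (λ x → ¬? (x ∈? rem b)) b

-- (s, s + 1, …, s + m − 1)
interval : ℕ → ℕ → List ℕ
interval s m = applyUpTo (λ j → s + j) m

-- The same for an integer length; empty if the length is negative.
intervalℤ : ℕ → ℤ → List ℕ
intervalℤ s (+ m)     = interval s m
intervalℤ s -[1+ _ ]  = []

-- The conditions on the aᵢ and tᵢ in the notation 𝐚 = ⨁ᵢ 𝐀ᵢ.
record Separated {k : ℕ} (a t : Vector ℕ k) : Set where
  field
    a-odd       : ∀ i → ¬ (2 ∣ a i)
    t-even      : ∀ i → 2 ∣ t i
    t-positive  : ∀ i → 2 ≤ t i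
    gap         : ∀ i j → toℕ j ≡ suc (toℕ i) → a i + (t i + 2) ≤ a j

⨁ : ∀ {k} → Vector ℕ k → Vector ℕ k → List ℕ
⨁ a t = concat (tabulate (λ i → interval (a i) (t i)))

-- aⱼ − 2 (t₁ + ⋯ + tⱼ₋₁) − tⱼ − 1
slack : ∀ {k} → Vector ℕ k → Vector ℕ k → Vector ℤ k
slack a t j = + a j ℤ.- + (2 * sumBefore t j) ℤ.- + t j ℤ.- 1ℤ

-- min ({cⱼ − s : j} ∪ {d − s})
minLength : ∀ {k} → Vector ℤ k → ℤ → ℤ → ℤ
minLength c d s = foldr ℤ._⊓_ (d ℤ.- s) (λ j → c j ℤ.- s)

-- (lᵢ, …, lₖ), given c = (cᵢ, …, cₖ) and s = l₁ + ⋯ + lᵢ₋₁.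
lengthsFrom : ∀ {k} → Vector ℤ k → ℤ → ℤ → Vector ℤ k
lengthsFrom c d s zero     = minLength c d s
lengthsFrom c d s (suc i)  = lengthsFrom (tail c) d (s ℤ.+ minLength c d s) i

-- (l₁, …, lₖ)
gapLengths : ∀ {k} → ℕ → Vector ℕ k → Vector ℕ k → Vector ℤ k
gapLengths l a t = lengthsFrom (slack a t) (+ l ℤ.- + sumℕ t) 0ℤ

-- l − t − (l₁ + ⋯ + lₖ)
lastLength : ∀ {k} → ℕ → Vector ℕ k → Vector ℕ k → ℤ
lastLength l a t = + l ℤ.- + sumℕ t ℤ.- sumℤ (gapLengths l a t)

-- The interval after 𝐀ᵢ has length lᵢ₊₁, and the one after 𝐀ₖ has length
-- lastLength; hence the lengths are indexed by Fin (suc k).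
preimage : ∀ {k} → ℕ → Vector ℕ k → Vector ℕ k → List ℕ
preimage {k} l a t =
  intervalℤ 1 (len zero)
    ++ concat (tabulate (λ i → interval (a i) (t i) ++ intervalℤ (a i + t i) (len (suc i))))
  where
  len : Vector ℤ (suc k)
  len = insertAt (gapLengths l a t) (fromℕ k) (lastLength l a t)

{-# OPTIONS --safe #-}
module Submission where

-- Read a column as a word of n symbols, one for each pair {2m − 1, 2m}, and read
-- "neither entry" as an opening and "both entries" as a closing bracket.  The
-- reduction replaces each unmatched closing bracket by an opening one.  In a word
-- all unmatched closing brackets precede all unmatched opening ones, so the word
-- is recovered from its reduction and the number of removed pairs, which the
-- length of the column determines: this is the injectivity of red.  For the
-- preimage, the condition on bₗ in the definition of rem compares the current
-- entry with the numbers of entries kept and removed so far.  The minima defining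
-- the lᵢ keep l₁ + ⋯ + lᵢ at most cᵢ, so that 𝐀ᵢ is kept, and equal to cᵢ when
-- lᵢ₊₁ > 0, so that the interval after 𝐀ᵢ is removed (where cᵢ = slack a t i).

open import Defs
open import Data.Bool using (Bool; true; false; if_then_else_)
open import Data.Fin using (Fin; zero; suc; toℕ; inject; inject₁; fromℕ)
open import Data.Integer as ℤ using (ℤ; 0ℤ; 1ℤ; +_)
open import Data.Integer.Divisibility as ℤ using ()
open import Data.Integer.Properties as ℤ using ()
open import Data.Integer.Tactic.RingSolver as ℤ-Solver using ()
open import Data.List using (List; []; _∷_; _++_; _ʳ++_; applyUpTo; concat; filter; length; lookup; reverse; tabulate)
open import Data.List.Membership.Propositional using (_∈_; _∉_)
open import Data.List.Properties
  using ( ∷-injective; ++-assoc; ++-identityʳ; ++-ʳ++; length-++; length-ʳ++; length-applyUpTo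
        ; length-reverse; reverse-involutive; reverse-injective
        ; filter-accept; filter-reject; filter-≐)
open import Data.List.Relation.Unary.All as All using (All; []; _∷_)
open import Data.List.Relation.Unary.All.Properties as All using ()
open import Data.List.Relation.Unary.AllPairs using (AllPairs; []; _∷_)
open import Data.List.Relation.Unary.Any using (here; there)
open import Data.List.Relation.Unary.Any.Properties using (reverse⁺; reverse⁻)
open import Data.List.Relation.Unary.Linked as Linked using (Linked; [-]; _∷_)
open import Data.List.Relation.Unary.Linked.Properties using (Linked⇒AllPairs; Linked⇒All)
open import Data.Nat using (ℕ; zero; suc; pred; _+_; _*_; _∸_; _⊓_; _≤_; _<_; _>_; z≤n; s≤s; _≟_; _<?_)
open import Data.List.Membership.DecPropositional _≟_ using (_∈?_)
open import Data.Nat.Divisibility using (_∣_; _∣?_; divides; m∣m*n; ∣m∣n⇒∣m+n; ∣m+n∣m⇒∣n; ∣1⇒≡1)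
open import Data.Nat.Properties
open import Data.Nat.Tactic.RingSolver using (solve-∀)
open import Data.Product using (_×_; _,_; proj₁; proj₂; ∃-syntax)
open import Data.Sum using (_⊎_; inj₁; inj₂)
open import Data.Vec using (Vec; []; _∷_)
open import Data.Vec.Functional using (Vector; foldr; tail; insertAt)
open import Data.Vec.Properties as Vec using ()
open import Function using (_∘_; case_of_)
open import Relation.Binary.PropositionalEquality
open import Relation.Nullary using (¬_; ¬?; Dec; yes; no; does; _×-dec_; contradiction)
open import Relation.Nullary.Decidable using (dec-true; dec-false)

-- Preliminaries on inequalities, parity and reversed lists

-- The equation says y - x = (v - u) + w without subtraction, so each use leaves only an identity
-- for the ring solver.
≤-by : ∀ {x y u v} w → u ≤ v → x + v + w ≡ y + u → x ≤ y
≤-by {x} {y} {u} {v} w u≤v eq = +-cancelʳ-≤ u x y (begin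
  x + u      ≤⟨ +-monoʳ-≤ x u≤v ⟩
  x + v      ≤⟨ m≤m+n (x + v) w ⟩
  x + v + w  ≡⟨ eq ⟩
  y + u      ∎)
  where open ≤-Reasoning

odd : ∀ m → ¬ (2 ∣ 1 + 2 * m)
odd m 2∣ with () ← ∣1⇒≡1 (∣m+n∣m⇒∣n (subst (2 ∣_) (+-comm 1 (2 * m)) 2∣) (m∣m*n m))

even : ∀ m → 2 ∣ 2 + 2 * m
even m = divides (suc m) (cong (λ x → 2 + x) (*-comm 2 m))

All-ʳ++ : ∀ {P : ℕ → Set} {xs ys} → All P xs → All P ys → All P (xs ʳ++ ys)
All-ʳ++ []         pys = pys
All-ʳ++ (px ∷ pxs) pys = All-ʳ++ pxs (px ∷ pys)

AllPairs-ʳ++ : ∀ {xs ys} → AllPairs _<_ xs → AllPairs _>_ ys →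
               All (λ x → All (_< x) ys) xs → AllPairs _>_ (xs ʳ++ ys)
AllPairs-ʳ++ []          dys []         = dys
AllPairs-ʳ++ (x< ∷ axs)  dys (<x ∷ <xs) =
  AllPairs-ʳ++ axs (<x ∷ dys) (All.zipWith (λ (p , q) → p ∷ q) (x< , <xs))

AllPairs-reverse : ∀ {xs} → AllPairs _<_ xs → AllPairs _>_ (reverse xs)
AllPairs-reverse axs = AllPairs-ʳ++ axs [] (All.universal (λ _ → []) _)

-- Removal on columns listed from the last entry to the first

Removable : ℕ → ℕ → List ℕ → Set
Removable x y bs = 2 ∣ x × y + 1 ≡ x × x + length (remʳ bs) + 1 < 2 * length (x ∷ y ∷ bs)

removable? : ∀ x y bs → Dec (Removable x y bs)
removable? x y bs = (2 ∣? x) ×-dec (y + 1 ≟ x)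
                    ×-dec (x + length (remʳ bs) + 1 <? 2 * length (x ∷ y ∷ bs))

-- Follows the recursion of `remʳ` but collects the kept entries, which makes the reduction
-- computable without membership tests.
redʳ : List ℕ → List ℕ
redʳ []           = []
redʳ (x ∷ [])     = x ∷ []
redʳ (x ∷ y ∷ bs) = if does (removable? x y bs) then redʳ bs else x ∷ redʳ (y ∷ bs)

module _ {x y : ℕ} (bs : List ℕ) where

  remʳ-remove : Removable x y bs → remʳ (x ∷ y ∷ bs) ≡ x ∷ y ∷ remʳ bs
  remʳ-remove r rewrite dec-true (removable? x y bs) r = refl

  remʳ-keep : ¬ Removable x y bs → remʳ (x ∷ y ∷ bs) ≡ remʳ (y ∷ bs)
  remʳ-keep r rewrite dec-false (removable? x y bs) r = refl

  redʳ-remove : Removable x y bs → redʳ (x ∷ y ∷ bs) ≡ redʳ bs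
  redʳ-remove r rewrite dec-true (removable? x y bs) r = refl

  redʳ-keep : ¬ Removable x y bs → redʳ (x ∷ y ∷ bs) ≡ x ∷ redʳ (y ∷ bs)
  redʳ-keep r rewrite dec-false (removable? x y bs) r = refl

-- Stands in for the inclusion of the removed entries in `c`. With the predicate `_< x` it shows
-- that a kept head `x` is not removed further down.
All-remʳ : ∀ {P : ℕ → Set} c → All P c → All P (remʳ c)
All-remʳ []           _                = []
All-remʳ (_ ∷ [])     _                = []
All-remʳ (x ∷ y ∷ bs) (px ∷ py ∷ pbs)
  with removable? x y bs | All-remʳ bs pbs | All-remʳ (y ∷ bs) (py ∷ pbs)
... | yes r | ih | _  = subst (All _) (sym (remʳ-remove bs r)) (px ∷ py ∷ ih)
... | no ¬r | _  | ih = subst (All _) (sym (remʳ-keep bs ¬r)) ih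

infix 5 _─_
_─_ : List ℕ → List ℕ → List ℕ
c ─ r = filter (λ x → ¬? (x ∈? r)) c

─-reject : ∀ {x} c r → x ∈ r → (x ∷ c) ─ r ≡ c ─ r
─-reject c r x∈r = filter-reject (λ w → ¬? (w ∈? r)) (λ x∉r → x∉r x∈r)

─-accept : ∀ {x} c r → x ∉ r → (x ∷ c) ─ r ≡ x ∷ (c ─ r)
─-accept c r = filter-accept (λ w → ¬? (w ∈? r))

─-∷ : ∀ {x} c r → All (_< x) c → c ─ (x ∷ r) ≡ c ─ r
─-∷ []      r []            = refl
─-∷ {x} (z ∷ c) r (z<x ∷ c<x) = case z ∈? r of λ where
    (yes z∈r) → begin
      (z ∷ c) ─ (x ∷ r)  ≡⟨ ─-reject c (x ∷ r) (there z∈r) ⟩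
      c ─ (x ∷ r)        ≡⟨ ─-∷ c r c<x ⟩
      c ─ r              ≡⟨ ─-reject c r z∈r ⟨
      (z ∷ c) ─ r        ∎
    (no z∉r) → begin
      (z ∷ c) ─ (x ∷ r)  ≡⟨ ─-accept c (x ∷ r) (λ { (here z≡x) → <⇒≢ z<x z≡x ; (there z∈r) → z∉r z∈r }) ⟩
      z ∷ (c ─ (x ∷ r))  ≡⟨ cong (z ∷_) (─-∷ c r c<x) ⟩
      z ∷ (c ─ r)        ≡⟨ ─-accept c r z∉r ⟨
      (z ∷ c) ─ r        ∎
  where open ≡-Reasoning

-- Induction along the common recursion. Strict descent makes each head differ from all later
-- entries: a removed pair cannot delete anything below it, and a kept head cannot be deleted by
-- what is removed below.
─-remʳ : ∀ c → AllPairs _>_ c → c ─ remʳ c ≡ redʳ c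
─-remʳ []           _  = refl
─-remʳ (_ ∷ [])     _  = refl
─-remʳ (x ∷ y ∷ bs) (x>@(_ ∷ x>bs) ∷ (y> ∷ dbs))
  with removable? x y bs | ─-remʳ bs dbs | ─-remʳ (y ∷ bs) (y> ∷ dbs)
... | yes r | ih | _ = begin
  (x ∷ y ∷ bs) ─ remʳ (x ∷ y ∷ bs)     ≡⟨ cong ((x ∷ y ∷ bs) ─_) (remʳ-remove bs r) ⟩
  (x ∷ y ∷ bs) ─ (x ∷ y ∷ remʳ bs)     ≡⟨ ─-reject (y ∷ bs) (x ∷ y ∷ remʳ bs) (here refl) ⟩
  (y ∷ bs) ─ (x ∷ y ∷ remʳ bs)         ≡⟨ ─-reject bs (x ∷ y ∷ remʳ bs) (there (here refl)) ⟩
  bs ─ (x ∷ y ∷ remʳ bs)               ≡⟨ ─-∷ bs (y ∷ remʳ bs) x>bs ⟩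
  bs ─ (y ∷ remʳ bs)                   ≡⟨ ─-∷ bs (remʳ bs) y> ⟩
  bs ─ remʳ bs                         ≡⟨ ih ⟩
  redʳ bs                              ≡⟨ redʳ-remove bs r ⟨
  redʳ (x ∷ y ∷ bs)                    ∎
  where open ≡-Reasoning
... | no ¬r | _ | ih = begin
  (x ∷ y ∷ bs) ─ remʳ (x ∷ y ∷ bs)     ≡⟨ cong ((x ∷ y ∷ bs) ─_) (remʳ-keep bs ¬r) ⟩
  (x ∷ y ∷ bs) ─ remʳ (y ∷ bs)         ≡⟨ ─-accept (y ∷ bs) (remʳ (y ∷ bs)) (λ x∈ → <-irrefl refl (All.lookup (All-remʳ (y ∷ bs) x>) x∈)) ⟩
  x ∷ ((y ∷ bs) ─ remʳ (y ∷ bs))       ≡⟨ cong (x ∷_) ih ⟩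
  x ∷ redʳ (y ∷ bs)                    ≡⟨ redʳ-keep bs ¬r ⟨
  redʳ (x ∷ y ∷ bs)                    ∎
  where open ≡-Reasoning

─-ʳ++ : ∀ xs {ys r} → (xs ʳ++ ys) ─ r ≡ (xs ─ r) ʳ++ (ys ─ r)
─-ʳ++ []                = refl
─-ʳ++ (x ∷ xs) {ys} {r} = trans (─-ʳ++ xs) (case x ∈? r of λ where
  (yes x∈r) → trans (cong ((xs ─ r) ʳ++_) (─-reject _ r x∈r)) (cong (_ʳ++ (ys ─ r)) (sym (─-reject _ r x∈r)))
  (no x∉r)  → trans (cong ((xs ─ r) ʳ++_) (─-accept _ r x∉r)) (cong (_ʳ++ (ys ─ r)) (sym (─-accept _ r x∉r))))

-- Filtering commutes with reversal, and reversing the list of removed entries does not change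
-- membership in it.
red≡redʳ : ∀ {b} → AllPairs _<_ b → red b ≡ reverse (redʳ (reverse b))
red≡redʳ {b} asc = begin
  b ─ reverse (remʳ c)          ≡⟨ filter-≐ (λ w → ¬? (w ∈? _)) (λ w → ¬? (w ∈? _))
                                     ((λ x∉ → x∉ ∘ reverse⁺) , (λ x∉ → x∉ ∘ reverse⁻)) b ⟩
  b ─ remʳ c                    ≡⟨ cong (_─ remʳ c) (reverse-involutive b) ⟨
  reverse c ─ remʳ c            ≡⟨ ─-ʳ++ c ⟩
  reverse (c ─ remʳ c)          ≡⟨ cong reverse (─-remʳ c (AllPairs-reverse asc)) ⟩
  reverse (redʳ c)              ∎
  where
  open ≡-Reasoning
  c = reverse b

module _ (m : ℕ) (c : List ℕ) where

  private
    top : 2 + 2 * m ≡ suc (2 * m) + 1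
    top = cong suc (+-comm 1 (2 * m))

  -- For the pair 2m + 1, 2m + 2 on top of `c`, the test in `rem` reads 2m + 3 + r < 2 (|c| + 2)
  -- with r the number of entries removed from `c`, that is, 2m + r ≤ 2 |c|.
  removable : 2 * m + length (remʳ c) ≤ 2 * length c → Removable (2 + 2 * m) (1 + 2 * m) c
  removable le = even m , sym top ,
    ≤-by 0 le (lemma (length (remʳ c)) (2 * m) (length c))
    where
    lemma : ∀ r u l → suc (2 + u + r + 1) + 2 * l + 0 ≡ 2 * (2 + l) + (u + r)
    lemma = solve-∀

  ¬removable : 2 * length c < 2 * m + length (remʳ c) → ¬ Removable (2 + 2 * m) (1 + 2 * m) c
  ¬removable lt (_ , _ , lt′) = <⇒≱ lt (≤-by 0 lt′ (lemma (length (remʳ c)) (2 * m) (length c)))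
    where
    lemma : ∀ r u l → u + r + 2 * (2 + l) + 0 ≡ 2 * l + suc (2 + u + r + 1)
    lemma = solve-∀

remʳ-skip : ∀ {x c} → All (λ y → ¬ (2 ∣ x × y + 1 ≡ x)) c → remʳ (x ∷ c) ≡ remʳ c
remʳ-skip []         = refl
remʳ-skip {c = _ ∷ c} (y≢ ∷ _) = remʳ-keep c (λ (e , eq , _) → y≢ (e , eq))

redʳ-skip : ∀ {x c} → All (λ y → ¬ (2 ∣ x × y + 1 ≡ x)) c → redʳ (x ∷ c) ≡ x ∷ redʳ c
redʳ-skip []         = refl
redʳ-skip {c = _ ∷ c} (y≢ ∷ _) = redʳ-keep c (λ (e , eq , _) → y≢ (e , eq))

-- This and `skip-even` are the two ways in which an unpaired head escapes removal: it is odd, or it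
-- is even and its partner `1 + 2 * m` is absent.
skip-odd : ∀ m {c} → All (λ y → ¬ (2 ∣ 1 + 2 * m × y + 1 ≡ 1 + 2 * m)) c
skip-odd m = All.universal (λ _ (e , _) → odd m e) _

skip-even : ∀ m {c} → All (_≤ 2 * m) c → All (λ y → ¬ (2 ∣ 2 + 2 * m × y + 1 ≡ 2 + 2 * m)) c
skip-even m = All.map λ {y} y≤ (_ , eq) →
  <⇒≢ (s≤s y≤) (suc-injective (trans (+-comm 1 y) eq))

module _ (m : ℕ) (c : List ℕ) (le : 2 * m + length (remʳ c) ≤ 2 * length c) where

  remʳ-double : remʳ (2 + 2 * m ∷ 1 + 2 * m ∷ c) ≡ 2 + 2 * m ∷ 1 + 2 * m ∷ remʳ c
  remʳ-double = remʳ-remove c (removable m c le)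

  redʳ-double : redʳ (2 + 2 * m ∷ 1 + 2 * m ∷ c) ≡ redʳ c
  redʳ-double = redʳ-remove c (removable m c le)

module _ (m : ℕ) (c : List ℕ) (lt : 2 * length c < 2 * m + length (remʳ c)) where

  remʳ-kept-double : remʳ (2 + 2 * m ∷ 1 + 2 * m ∷ c) ≡ remʳ c
  remʳ-kept-double = trans (remʳ-keep c (¬removable m c lt)) (remʳ-skip (skip-odd m {c}))

  redʳ-kept-double : redʳ (2 + 2 * m ∷ 1 + 2 * m ∷ c) ≡ 2 + 2 * m ∷ 1 + 2 * m ∷ redʳ c
  redʳ-kept-double = trans (redʳ-keep c (¬removable m c lt)) (cong (2 + 2 * m ∷_) (redʳ-skip (skip-odd m {c})))

-- Columns as words

-- The m-th symbol, counted from the end of the vector, records whether 2m and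
-- 2m − 1 occur in the column.
Symbol : Set
Symbol = Bool × Bool

emit : Bool → ℕ → List ℕ → List ℕ
emit true  x c = x ∷ c
emit false x c = c

render : ∀ {n} → Vec Symbol n → List ℕ
render             []            = []
render {suc n} ((h , l) ∷ w) = emit h (2 + 2 * n) (emit l (1 + 2 * n) (render w))

emit-bound : ∀ h {m c} → All (_≤ m) c → All (_≤ suc m) (emit h (suc m) c)
emit-bound true  c≤ = ≤-refl ∷ All.map m≤n⇒m≤1+n c≤
emit-bound false c≤ = All.map m≤n⇒m≤1+n c≤

2*suc : ∀ n → 2 * suc n ≡ 2 + 2 * n
2*suc = solve-∀

render-bound : ∀ {n} (w : Vec Symbol n) → All (_≤ 2 * n) (render w)
render-bound []                      = []
render-bound {suc n} ((h , l) ∷ w) =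
  subst (λ m → All (_≤ m) (render ((h , l) ∷ w))) (sym (2*suc n)) (emit-bound h (emit-bound l (render-bound w)))

emit-injective : ∀ h h′ {m c c′} → All (_≤ m) c → All (_≤ m) c′ →
                 emit h (suc m) c ≡ emit h′ (suc m) c′ → h ≡ h′ × c ≡ c′
emit-injective true  true  _        _         eq   = refl , proj₂ (∷-injective eq)
emit-injective false false _        _         eq   = refl , eq
emit-injective true  false _        (x≤ ∷ _)  refl = contradiction x≤ (n≮n _)
emit-injective false true  (x≤ ∷ _) _         refl = contradiction x≤ (n≮n _)

render-injective : ∀ {n} (w w′ : Vec Symbol n) → render w ≡ render w′ → w ≡ w′
render-injective []            []              _  = refl
render-injective ((h , l) ∷ w) ((h′ , l′) ∷ w′) eq
  with refl , eq₁ ← emit-injective h h′ (emit-bound l (render-bound w)) (emit-bound l′ (render-bound w′)) eq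
  with refl , eq₂ ← emit-injective l l′ (render-bound w) (render-bound w′) eq₁
  = cong (_ ∷_) (render-injective w w′ eq₂)

-- Strict descent allows `suc m` only as the head. The last component passes any property of the
-- entries on to the rest; it carries the bound `1 ≤_` along.
emit-surjective : ∀ {m c} → AllPairs _>_ c → All (_≤ suc m) c →
                  ∃[ h ] ∃[ c′ ] c ≡ emit h (suc m) c′ × AllPairs _>_ c′ × All (_≤ m) c′
                  × (∀ {P : ℕ → Set} → All P c → All P c′)
emit-surjective []          []           = false , [] , refl , [] , [] , λ p → p
emit-surjective {m} {x ∷ c} (x> ∷ dc) (x≤ ∷ c≤) with m≤n⇒m<n∨m≡n x≤
... | inj₂ refl      = true , c , refl , dc , All.map ≤-pred x> , λ { (_ ∷ p) → p }
... | inj₁ (s≤s x≤m) = false , x ∷ c , refl , x> ∷ dc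
                     , x≤m ∷ All.map (λ y<x → ≤-trans (<⇒≤ y<x) x≤m) x> , λ p → p

render-surjective : ∀ n {c} → AllPairs _>_ c → All (1 ≤_) c → All (_≤ 2 * n) c →
                    ∃[ w ] c ≡ render {n} w
render-surjective zero    {[]}    _  _         _        = [] , refl
render-surjective zero    {x ∷ c} _  (1≤x ∷ _) (x≤0 ∷ _) = contradiction (≤-trans 1≤x x≤0) λ ()
render-surjective (suc n) {c} dc 1≤c c≤
  with h , c₁ , refl , d₁ , b₁ , f₁ ← emit-surjective dc (subst (λ m → All (_≤ m) c) (2*suc n) c≤)
  with l , c₂ , refl , d₂ , b₂ , f₂ ← emit-surjective d₁ b₁
  with w , refl ← render-surjective n d₂ (f₂ (f₁ 1≤c)) b₂
  = (h , l) ∷ w , refl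

-- Reading (false , false) as an opening and (true , true) as a closing bracket,
-- opens counts the unmatched opening brackets.
opensAt : Symbol → ℕ → ℕ
opensAt (true  , true)  o = pred o
opensAt (true  , false) o = o
opensAt (false , true)  o = o
opensAt (false , false) o = suc o

opens : ∀ {n} → Vec Symbol n → ℕ
opens []      = 0
opens (s ∷ w) = opensAt s (opens w)

redAt : Symbol → ℕ → Symbol
redAt (true  , true)  zero    = false , false
redAt (true  , true)  (suc _) = true , true
redAt (true  , false) _       = true , false
redAt (false , l)     _       = false , l

redWord : ∀ {n} → Vec Symbol n → Vec Symbol n
redWord []      = []
redWord (s ∷ w) = redAt s (opens w) ∷ redWord w

removedAt : Symbol → ℕ → ℕ
removedAt (true  , true)  zero    = 1
removedAt (true  , true)  (suc _) = 0
removedAt (true  , false) _       = 0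
removedAt (false , _)     _       = 0

removed : ∀ {n} → Vec Symbol n → ℕ
removed []      = 0
removed (s ∷ w) = removedAt s (opens w) + removed w

-- Both n - |w| and `opens w` - `removed w` equal the number of empty symbols minus the number of
-- full ones: a full symbol either closes an empty one or is removed. This links positions and
-- lengths to brackets.
balance : ∀ {n} (w : Vec Symbol n) → n + removed w ≡ length (render w) + opens w
balance []                      = refl
balance ((false , false) ∷ w)   = trans (cong suc (balance w)) (sym (+-suc _ _))
balance ((false , true)  ∷ w)   = cong suc (balance w)
balance ((true  , false) ∷ w)   = cong suc (balance w)
balance {suc n} ((true , true) ∷ w) with opens w | balance w
... | zero  | eq = trans (cong suc (+-suc n (removed w))) (cong (λ x → 2 + x) eq)
... | suc o | eq = cong suc (trans eq (+-suc (length (render w)) o))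

module _ {n} (w : Vec Symbol n) (ih : length (remʳ (render w)) ≡ 2 * removed w) where

  private
    double-balance : 2 * n + length (remʳ (render w)) ≡ 2 * (length (render w) + opens w)
    double-balance = begin
      2 * n + length (remʳ (render w))   ≡⟨ cong (λ x → 2 * n + x) ih ⟩
      2 * n + 2 * removed w              ≡⟨ *-distribˡ-+ 2 n _ ⟨
      2 * (n + removed w)                ≡⟨ cong (2 *_) (balance w) ⟩
      2 * (length (render w) + opens w)  ∎
      where open ≡-Reasoning

  -- Doubling `balance` gives 2n + |rem| = 2 |w| + 2 `opens w`. Hence the numerical test for a pair
  -- on top of `w` succeeds here and fails in `open-left`, where an opening bracket is still
  -- unmatched.
  closed : opens w ≡ 0 → 2 * n + length (remʳ (render w)) ≤ 2 * length (render w)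
  closed eq = ≤-reflexive (trans double-balance
    (cong (2 *_) (trans (cong (λ x → length (render w) + x) eq) (+-identityʳ (length (render w))))))

  open-left : ∀ {o} → opens w ≡ suc o → 2 * length (render w) < 2 * n + length (remʳ (render w))
  open-left {o} eq = begin-strict
    2 * length (render w)             <⟨ *-monoʳ-< 2 (m<m+n (length (render w)) {suc o} (s≤s z≤n)) ⟩
    2 * (length (render w) + suc o)   ≡⟨ cong (λ o → 2 * (length (render w) + o)) eq ⟨
    2 * (length (render w) + opens w) ≡⟨ double-balance ⟨
    2 * n + length (remʳ (render w))  ∎
    where open ≤-Reasoning

-- Induction on the word. Only a full symbol consults the test, and there the count for the rest,
-- which the test involves, is the induction hypothesis.
remʳ-render : ∀ {n} (w : Vec Symbol n) → length (remʳ (render w)) ≡ 2 * removed w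
remʳ-render []                        = refl
remʳ-render ((false , false) ∷ w)     = remʳ-render w
remʳ-render {suc n} ((false , true) ∷ w) =
  trans (cong length (remʳ-skip (skip-odd n {render w}))) (remʳ-render w)
remʳ-render {suc n} ((true , false) ∷ w) =
  trans (cong length (remʳ-skip {c = render w} (skip-even n (render-bound w)))) (remʳ-render w)
remʳ-render {suc n} ((true , true) ∷ w) with opens w in eq
... | zero  = trans (cong length (remʳ-double n (render w) (closed w (remʳ-render w) eq)))
                (trans (cong (λ x → 2 + x) (remʳ-render w)) (sym (2*suc (removed w))))
... | suc o = trans (cong length (remʳ-kept-double n (render w) (open-left w (remʳ-render w) eq))) (remʳ-render w)

redʳ-render : ∀ {n} (w : Vec Symbol n) → redʳ (render w) ≡ render (redWord w)
redʳ-render []                        = refl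
redʳ-render ((false , false) ∷ w)     = redʳ-render w
redʳ-render {suc n} ((false , true) ∷ w) =
  trans (redʳ-skip (skip-odd n {render w})) (cong (_ ∷_) (redʳ-render w))
redʳ-render {suc n} ((true , false) ∷ w) =
  trans (redʳ-skip {c = render w} (skip-even n (render-bound w))) (cong (_ ∷_) (redʳ-render w))
redʳ-render {suc n} ((true , true) ∷ w) with opens w in eq
... | zero  = trans (redʳ-double n (render w) (closed w (remʳ-render w) eq)) (redʳ-render w)
... | suc o = trans (redʳ-kept-double n (render w) (open-left w (remʳ-render w) eq))
                (cong (λ c → _ ∷ _ ∷ c) (redʳ-render w))

-- Injectivity of the reduction

length-emit : ∀ h x c c′ k → length c ≡ k + length c′ → length (emit h x c) ≡ k + length (emit h x c′)
length-emit true  x c c′ k eq = trans (cong suc eq) (sym (+-suc k _))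
length-emit false x c c′ k eq = eq

length-redWord : ∀ {n} (w : Vec Symbol n) → length (render w) ≡ 2 * removed w + length (render (redWord w))
length-redWord []                            = refl
length-redWord {suc n} ((false , l) ∷ w)     =
  length-emit l (1 + 2 * n) (render w) (render (redWord w)) (2 * removed w) (length-redWord w)
length-redWord {suc n} ((true , false) ∷ w)  =
  length-emit true (2 + 2 * n) (render w) (render (redWord w)) (2 * removed w) (length-redWord w)
length-redWord {suc n} ((true , true) ∷ w) with opens w
... | zero  = trans (cong (λ x → 2 + x) (length-redWord w)) (cong (_+ length (render (redWord w))) (sym (2*suc (removed w))))
... | suc _ = length-emit true (2 + 2 * n) (1 + 2 * n ∷ render w) (1 + 2 * n ∷ render (redWord w)) (2 * removed w)
                (length-emit true (1 + 2 * n) (render w) (render (redWord w)) (2 * removed w) (length-redWord w))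

-- Where two words with the same reduction first differ, one of them has a
-- removed pair and the other an empty symbol; from there on the latter keeps
-- an unmatched opening bracket, so it never catches up in removed pairs.
Behind : ∀ {n} → Vec Symbol n → Vec Symbol n → Set
Behind w w′ = removed w < removed w′ × opens w′ < opens w

-- With an unmatched opening bracket available, a closing one is matched, so the reduction changes
-- nothing.
redAt-suc : ∀ s o → redAt s (suc o) ≡ s
redAt-suc (true  , true)  o = refl
redAt-suc (true  , false) o = refl
redAt-suc (false , l)     o = refl

-- Here `s` is the symbol of the word that is ahead in removed pairs. The other word has `o` > 0, so
-- its symbol is already reduced and must be `redAt s o′`.
Behind-step : ∀ s {o o′ r r′} → r < r′ → o′ < o →
              removedAt (redAt s o′) o + r < removedAt s o′ + r′
              × opensAt s o′ < opensAt (redAt s o′) o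
Behind-step (true  , true)  {suc o} {zero}   r< o<       = m<n⇒m<1+n r< , s≤s z≤n
Behind-step (true  , true)  {suc o} {suc o′} r< (s≤s o<) = r< , o<
Behind-step (true  , false)                  r< o<       = r< , o<
Behind-step (false , true)                   r< o<       = r< , o<
Behind-step (false , false)                  r< o<       = r< , s≤s o<

Behind-∷ : ∀ {n} s s′ (w w′ : Vec Symbol n) → Behind w w′ →
           redAt s (opens w) ≡ redAt s′ (opens w′) → Behind (s ∷ w) (s′ ∷ w′)
Behind-∷ s s′ w w′ (r< , o<) eq with opens w
-- The strict inequality between the open counts excludes `opens w` = 0; the rewriting then
-- expresses `s` through `s′`.
... | suc o rewrite trans (sym (redAt-suc s o)) eq = Behind-step s′ r< o<

-- At a positive count nothing is reduced. At count 0 the only two symbols with the same reduction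
-- are the full and the empty one, and the full one is removed.
differ-step : ∀ s s′ o → redAt s o ≡ redAt s′ o →
              s ≡ s′ ⊎ (removedAt s o < removedAt s′ o × opensAt s′ o < opensAt s o)
              ⊎ (removedAt s′ o < removedAt s o × opensAt s o < opensAt s′ o)
differ-step s s′ (suc o) eq = inj₁ (trans (sym (redAt-suc s o)) (trans eq (redAt-suc s′ o)))
differ-step (true  , true)  (true  , true)  zero eq   = inj₁ refl
differ-step (true  , true)  (false , false) zero refl = inj₂ (inj₂ (s≤s z≤n , s≤s z≤n))
differ-step (false , false) (true  , true)  zero refl = inj₂ (inj₁ (s≤s z≤n , s≤s z≤n))
differ-step (false , true)  (true  , true)  zero ()
differ-step (false , true)  (true  , false) zero ()
differ-step (true  , false) (true  , false) zero refl = inj₁ refl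
differ-step (false , l)     (false , l)     zero refl = inj₁ refl

compare-words : ∀ {n} (w w′ : Vec Symbol n) → redWord w ≡ redWord w′ →
                w ≡ w′ ⊎ Behind w w′ ⊎ Behind w′ w
compare-words []      []        eq = inj₁ refl
compare-words (s ∷ w) (s′ ∷ w′) eq with Vec.∷-injective eq
... | eqₛ , eq′ with compare-words w w′ eq′
... | inj₂ (inj₁ b) = inj₂ (inj₁ (Behind-∷ s s′ w w′ b eqₛ))
... | inj₂ (inj₂ b) = inj₂ (inj₂ (Behind-∷ s′ s w′ w b (sym eqₛ)))
... | inj₁ refl with differ-step s s′ (opens w) eqₛ
...   | inj₁ refl            = inj₁ refl
...   | inj₂ (inj₁ (r , o))  = inj₂ (inj₁ (+-monoˡ-< (removed w) r , o))
...   | inj₂ (inj₂ (r , o))  = inj₂ (inj₂ (+-monoˡ-< (removed w) r , o))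

-- Each removed pair accounts for two entries lost in the reduction, so the two lengths fix the
-- count.
removed-determined : ∀ {n} (w w′ : Vec Symbol n) → length (render w) ≡ length (render w′) →
                     redWord w ≡ redWord w′ → removed w ≡ removed w′
removed-determined w w′ len eq =
  *-cancelˡ-≡ _ _ 2 (+-cancelʳ-≡ (length (render (redWord w′))) _ _ (begin
    2 * removed w  + length (render (redWord w′))  ≡⟨ cong (λ v → 2 * removed w + length (render v)) eq ⟨
    2 * removed w  + length (render (redWord w))   ≡⟨ length-redWord w ⟨
    length (render w)                              ≡⟨ len ⟩
    length (render w′)                             ≡⟨ length-redWord w′ ⟩
    2 * removed w′ + length (render (redWord w′))  ∎))
  where open ≡-Reasoning

redWord-injective : ∀ {n} (w w′ : Vec Symbol n) → length (render w) ≡ length (render w′) →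
                    redWord w ≡ redWord w′ → w ≡ w′
redWord-injective w w′ len eq with compare-words w w′ eq
... | inj₁ w≡w′            = w≡w′
... | inj₂ (inj₁ (r< , _)) = contradiction (removed-determined w w′ len eq) (<⇒≢ r<)
... | inj₂ (inj₂ (r< , _)) = contradiction (removed-determined w′ w (sym len) (sym eq)) (<⇒≢ r<)

column-word : ∀ {n l b} → SST n l b →
              ∃[ w ] reverse b ≡ render {n} w × length (render w) ≡ l
              × red b ≡ reverse (render (redWord w))
column-word {n} {l} {b} sst
  with asc ← Linked⇒AllPairs <-trans (SST.strict sst)
  with w , eq ← render-surjective n (AllPairs-reverse asc)
                  (All-ʳ++ (All.map proj₁ (SST.entries sst)) [])
                  (All-ʳ++ (All.map proj₂ (SST.entries sst)) [])
  = w , eq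
  , trans (cong length (sym eq)) (trans (length-reverse b) (SST.length≡ sst))
  , trans (red≡redʳ asc) (cong reverse (trans (cong redʳ eq) (redʳ-render w)))

red-injective : ∀ {n l b b′} → SST n l b → SST n l b′ → red b ≡ red b′ → b ≡ b′
red-injective sst sst′ eq
  with w  , eq₁ , len₁ , red₁ ← column-word sst
  with w′ , eq₂ , len₂ , red₂ ← column-word sst′
  = reverse-injective (trans eq₁ (trans (cong render (redWord-injective w w′ (trans len₁ (sym len₂))
      (render-injective _ _ (reverse-injective (trans (sym red₁) (trans eq red₂)))))) (sym eq₂)))

-- Runs of adjacent pairs, and columns composed of them

pairs : ℕ → ℕ → List ℕ
pairs u zero    = []
pairs u (suc g) = 1 + 2 * u ∷ 2 + 2 * u ∷ pairs (suc u) g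

applyUpTo-cong : ∀ {f g : ℕ → ℕ} → (∀ i → f i ≡ g i) → ∀ n → applyUpTo f n ≡ applyUpTo g n
applyUpTo-cong f≗g zero    = refl
applyUpTo-cong f≗g (suc n) = cong₂ _∷_ (f≗g 0) (applyUpTo-cong (λ i → f≗g (suc i)) n)

interval-pairs : ∀ u g → interval (1 + 2 * u) (2 * g) ≡ pairs u g
interval-pairs u zero    = refl
interval-pairs u (suc g) = begin
  interval (1 + 2 * u) (2 * suc g)
    ≡⟨ cong (interval (1 + 2 * u)) (2*suc g) ⟩
  interval (1 + 2 * u) (2 + 2 * g)
    ≡⟨ cong₂ _∷_ (first u) (cong₂ _∷_ (second u) (applyUpTo-cong (shift u) (2 * g))) ⟩
  1 + 2 * u ∷ 2 + 2 * u ∷ interval (1 + 2 * suc u) (2 * g)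
    ≡⟨ cong (λ xs → 1 + 2 * u ∷ 2 + 2 * u ∷ xs) (interval-pairs (suc u) g) ⟩
  pairs u (suc g) ∎
  where
  open ≡-Reasoning
  first : ∀ u → 1 + 2 * u + 0 ≡ 1 + 2 * u
  first = solve-∀
  second : ∀ u → 1 + 2 * u + 1 ≡ 2 + 2 * u
  second = solve-∀
  shift : ∀ u i → 1 + 2 * u + (2 + i) ≡ 1 + 2 * suc u + i
  shift = solve-∀

length-pairs : ∀ u g → length (pairs u g) ≡ 2 * g
length-pairs u zero    = refl
length-pairs u (suc g) = trans (cong (λ x → 2 + x) (length-pairs (suc u) g)) (sym (2*suc g))

module _ (u : ℕ) (c : List ℕ) where

  private
    c′ : List ℕ
    c′ = 2 + 2 * u ∷ 1 + 2 * u ∷ c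

  -- Removing a pair raises both sides by 4: on the left 2 from `u` and 2 from the removed entries,
  -- on the right twice the two new entries.
  closed-suc : 2 * u + length (remʳ c) ≤ 2 * length c → 2 * suc u + length (remʳ c′) ≤ 2 * length c′
  closed-suc le rewrite remʳ-double u c le = ≤-by 0 le (lemma u (length (remʳ c)) (length c))
    where
    lemma : ∀ u r l → 2 * suc u + (2 + r) + 2 * l + 0 ≡ 2 * (2 + l) + (2 * u + r)
    lemma = solve-∀

  open-now : ∀ {g} → 2 * length c + 2 * suc g ≤ suc (2 * u + length (remʳ c)) →
             2 * length c < 2 * u + length (remʳ c)
  open-now {g} le = ≤-by (2 * g) le (lemma g (length c) (2 * u + length (remʳ c)))
    where
    lemma : ∀ g l k → suc (2 * l) + suc k + 2 * g ≡ k + (2 * l + 2 * suc g)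
    lemma = solve-∀

  -- A kept pair raises 2 |c| by 4 but 2u only by 2. The term 2g is the margin that the pairs still
  -- to come will use up.
  open-suc : ∀ {g} → 2 * length c + 2 * suc g ≤ suc (2 * u + length (remʳ c)) →
             2 * length c′ + 2 * g ≤ suc (2 * suc u + length (remʳ c′))
  open-suc {g} le rewrite remʳ-kept-double u c (open-now {g} le) = ≤-by 0 le (lemma g u (length (remʳ c)) (length c))
    where
    lemma : ∀ g u r l → 2 * (2 + l) + 2 * g + suc (2 * u + r) + 0 ≡ suc (2 * suc u + r) + (2 * l + 2 * suc g)
    lemma = solve-∀

remʳ-removed-pairs : ∀ g u c → 2 * u + length (remʳ c) ≤ 2 * length c →
                     length (remʳ (pairs u g ʳ++ c)) ≡ 2 * g + length (remʳ c)
remʳ-removed-pairs zero    u c le = refl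
remʳ-removed-pairs (suc g) u c le = begin
  length (remʳ (pairs (suc u) g ʳ++ c′))  ≡⟨ remʳ-removed-pairs g (suc u) c′ (closed-suc u c le) ⟩
  2 * g + length (remʳ c′)                ≡⟨ cong (λ r → 2 * g + length r) (remʳ-double u c le) ⟩
  2 * g + (2 + length (remʳ c))           ≡⟨ lemma g (length (remʳ c)) ⟩
  2 * suc g + length (remʳ c)             ∎
  where
  open ≡-Reasoning
  c′ = 2 + 2 * u ∷ 1 + 2 * u ∷ c
  lemma : ∀ g r → 2 * g + (2 + r) ≡ 2 * suc g + r
  lemma = solve-∀

redʳ-removed-pairs : ∀ g u c → 2 * u + length (remʳ c) ≤ 2 * length c →
                     redʳ (pairs u g ʳ++ c) ≡ redʳ c
redʳ-removed-pairs zero    u c le = refl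
redʳ-removed-pairs (suc g) u c le =
  trans (redʳ-removed-pairs g (suc u) _ (closed-suc u c le)) (redʳ-double u c le)

remʳ-kept-pairs : ∀ g u c → 2 * length c + 2 * g ≤ suc (2 * u + length (remʳ c)) →
                  remʳ (pairs u g ʳ++ c) ≡ remʳ c
remʳ-kept-pairs zero    u c le = refl
remʳ-kept-pairs (suc g) u c le =
  trans (remʳ-kept-pairs g (suc u) _ (open-suc u c {g} le)) (remʳ-kept-double u c (open-now u c {g} le))

redʳ-kept-pairs : ∀ g u c → 2 * length c + 2 * g ≤ suc (2 * u + length (remʳ c)) →
                  redʳ (pairs u g ʳ++ c) ≡ pairs u g ʳ++ redʳ c
redʳ-kept-pairs zero    u c le = refl
redʳ-kept-pairs (suc g) u c le =
  trans (redʳ-kept-pairs g (suc u) _ (open-suc u c {g} le))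
        (cong (pairs (suc u) g ʳ++_) (redʳ-kept-double u c (open-now u c {g} le)))

-- Layout n m u β σ T A describes how T continues a column of which all entries
-- are at most 2u, with 2β entries surviving the reduction and 2σ removed ones.
-- Blocks of T are alternately removed and kept; the kept ones make up A.  The
-- whole column has length 2m.  In these halves, rem removes the next pair iff
-- u ≤ 2β + σ, a condition that persists while pairs are removed.
data Layout (n m : ℕ) : ℕ → ℕ → ℕ → List ℕ → List ℕ → Set where
  end   : ∀ {u β σ} g → g ≡ 0 ⊎ u ≤ 2 * β + σ → u + g ≤ n → β + σ + g ≡ m →
          Layout n m u β σ (pairs u g) []
  block : ∀ {u β σ α τ T A} g → g ≡ 0 ⊎ u ≤ 2 * β + σ → u + g ≤ α → 2 * β + (σ + g) + τ ≤ α →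
          Layout n m (α + τ) (β + τ) (σ + g) T A →
          Layout n m u β σ (pairs u g ++ (pairs α τ ++ T)) (pairs α τ ++ A)

length-Layout : ∀ {n m u β σ T A} → Layout n m u β σ T A → length T + 2 * (β + σ) ≡ 2 * m
length-Layout {u = u} {β} {σ} (end g _ _ eq) =
  trans (cong (_+ 2 * (β + σ)) (length-pairs u g)) (trans (lemma g (β + σ)) (cong (2 *_) eq))
  where
  lemma : ∀ g k → 2 * g + 2 * k ≡ 2 * (k + g)
  lemma = solve-∀
length-Layout {m = m} {u = u} {β} {σ} (block {α = α} {τ} {T} g _ _ _ lay) = begin
  length (pairs u g ++ (pairs α τ ++ T)) + 2 * (β + σ)
    ≡⟨ cong (_+ 2 * (β + σ)) (trans (length-++ (pairs u g)) (cong₂ _+_ (length-pairs u g)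
         (trans (length-++ (pairs α τ)) (cong (_+ length T) (length-pairs α τ))))) ⟩
  2 * g + (2 * τ + length T) + 2 * (β + σ)
    ≡⟨ lemma g τ (length T) β σ ⟩
  length T + 2 * (β + τ + (σ + g))
    ≡⟨ length-Layout lay ⟩
  2 * m ∎
  where
  open ≡-Reasoning
  lemma : ∀ g τ k β σ → 2 * g + (2 * τ + k) + 2 * (β + σ) ≡ k + 2 * (β + τ + (σ + g))
  lemma = solve-∀

Linked-weaken : ∀ {v w xs} → v ≤ w → Linked _<_ (w ∷ xs) → Linked _<_ (v ∷ xs)
Linked-weaken v≤w [-]          = [-]
Linked-weaken v≤w (w<x ∷ lxs)  = ≤-<-trans v≤w w<x ∷ lxs

Linked-pairs : ∀ {xs} u g → Linked _<_ (2 * (u + g) ∷ xs) → Linked _<_ (2 * u ∷ pairs u g ++ xs)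
Linked-pairs {xs} u zero    lxs = subst (λ v → Linked _<_ (2 * v ∷ xs)) (+-identityʳ u) lxs
Linked-pairs {xs} u (suc g) lxs =
  ≤-refl ∷ ≤-refl ∷ subst (λ v → Linked _<_ (v ∷ pairs (suc u) g ++ xs)) (2*suc u)
    (Linked-pairs (suc u) g (subst (λ v → Linked _<_ (2 * v ∷ xs)) (+-suc u g) lxs))

-- The extra head `2 * u` is a barrier below the column: through it consecutive runs are glued, and
-- for `u` = 0 it gives the positivity of the entries.
Linked-Layout : ∀ {n m u β σ T A} → Layout n m u β σ T A → Linked _<_ (2 * u ∷ T)
Linked-Layout {u = u} (end g _ _ _) =
  subst (λ xs → Linked _<_ (2 * u ∷ xs)) (++-identityʳ (pairs u g)) (Linked-pairs u g [-])
Linked-Layout {u = u} (block {α = α} {τ} g _ u+g≤α _ lay) =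
  Linked-pairs u g (Linked-weaken (*-monoʳ-≤ 2 u+g≤α) (Linked-pairs α τ (Linked-Layout lay)))

pairs-bound : ∀ {n} u g → u + g ≤ n → All (_≤ 2 * n) (pairs u g)
pairs-bound u zero    u+g≤n = []
pairs-bound {n} u (suc g) u+g≤n =
  <⇒≤ le ∷ le ∷ pairs-bound (suc u) g (subst (_≤ n) (+-suc u g) u+g≤n)
  where
  le : 2 + 2 * u ≤ 2 * n
  le = subst (_≤ 2 * n) (2*suc u) (*-monoʳ-≤ 2 (≤-trans (s≤s (m≤m+n u g)) (subst (_≤ n) (+-suc u g) u+g≤n)))

start≤ : ∀ {n m u β σ T A} → Layout n m u β σ T A → u ≤ n
start≤ {u = u} (end g _ u+g≤n _) = ≤-trans (m≤m+n u g) u+g≤n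
start≤ {u = u} (block {α = α} {τ} g _ u+g≤α _ lay) =
  ≤-trans (m≤m+n u g) (≤-trans u+g≤α (≤-trans (m≤m+n α τ) (start≤ lay)))

Layout-bound : ∀ {n m u β σ T A} → Layout n m u β σ T A → All (_≤ 2 * n) T
Layout-bound {u = u} (end g _ u+g≤n _) = pairs-bound u g u+g≤n
Layout-bound {u = u} (block {α = α} {τ} g _ u+g≤α _ lay) =
  All.++⁺ (pairs-bound u g (≤-trans u+g≤α (≤-trans (m≤m+n α τ) (start≤ lay))))
    (All.++⁺ (pairs-bound α τ (start≤ lay)) (Layout-bound lay))

Layout⇒SST : ∀ {n m T A} → Layout n m 0 0 0 T A → SST n (2 * m) T
Layout⇒SST {T = T} lay = record
  { length≡ = trans (sym (+-identityʳ (length T))) (length-Layout lay)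
  ; strict  = Linked.tail (Linked-Layout lay)
  ; entries = All.zip (positive (Linked-Layout lay) , Layout-bound lay)
  }
  where
  positive : ∀ {T} → Linked _<_ (0 ∷ T) → All (1 ≤_) T
  positive [-]         = []
  positive (0<x ∷ lxs) = Linked⇒All <-trans 0<x lxs

module _ {β σ c} (rem≡ : length (remʳ c) ≡ 2 * σ) (len≡ : length c ≡ 2 * (β + σ)) where

  private
    closed′ : ∀ u → u ≤ 2 * β + σ → 2 * u + length (remʳ c) ≤ 2 * length c
    closed′ u u≤ rewrite rem≡ | len≡ = ≤-by 0 (*-monoʳ-≤ 2 u≤) (lemma u β σ)
      where
      lemma : ∀ u β σ → 2 * u + 2 * σ + 2 * (2 * β + σ) + 0 ≡ 2 * (2 * (β + σ)) + 2 * u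
      lemma = solve-∀

  rem-gap : ∀ u g → g ≡ 0 ⊎ u ≤ 2 * β + σ → length (remʳ (pairs u g ʳ++ c)) ≡ 2 * (σ + g)
  rem-gap u g (inj₁ refl) = trans rem≡ (cong (2 *_) (sym (+-identityʳ σ)))
  rem-gap u g (inj₂ u≤)   =
    trans (remʳ-removed-pairs g u c (closed′ u u≤)) (trans (cong (λ x → 2 * g + x) rem≡) (lemma g σ))
    where
    lemma : ∀ g σ → 2 * g + 2 * σ ≡ 2 * (σ + g)
    lemma = solve-∀

  red-gap : ∀ u g → g ≡ 0 ⊎ u ≤ 2 * β + σ → redʳ (pairs u g ʳ++ c) ≡ redʳ c
  red-gap u g (inj₁ refl) = refl
  red-gap u g (inj₂ u≤)   = redʳ-removed-pairs g u c (closed′ u u≤)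

length-pairs-ʳ++ : ∀ u g c {k} → length c ≡ 2 * k → length (pairs u g ʳ++ c) ≡ 2 * (k + g)
length-pairs-ʳ++ u g c {k} eq =
  trans (length-ʳ++ (pairs u g)) (trans (cong₂ _+_ (length-pairs u g) eq) (lemma g k))
  where
  lemma : ∀ g k → 2 * g + 2 * k ≡ 2 * (k + g)
  lemma = solve-∀

-- The part read so far is an accumulator `c`, of which the induction needs only the numbers of
-- removed and of all entries. A removed run leaves `redʳ` unchanged, and a kept run is passed
-- through whole.
redʳ-Layout : ∀ {n m u β σ T A} → Layout n m u β σ T A →
              ∀ c → length (remʳ c) ≡ 2 * σ → length c ≡ 2 * (β + σ) →
              redʳ (T ʳ++ c) ≡ A ʳ++ redʳ c
redʳ-Layout {u = u} {β} (end g cond _ _) c rem≡ len≡ = red-gap {β = β} rem≡ len≡ u g cond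
redʳ-Layout {u = u} {β} {σ} (block {α = α} {τ} {T} {A} g cond _ open′ lay) c rem≡ len≡ = begin
  redʳ ((pairs u g ++ (pairs α τ ++ T)) ʳ++ c)
    ≡⟨ cong redʳ (trans (++-ʳ++ (pairs u g)) (++-ʳ++ (pairs α τ))) ⟩
  redʳ (T ʳ++ c₂)
    ≡⟨ redʳ-Layout lay c₂ (trans (cong length (remʳ-kept-pairs τ α c₁ le)) rem₁) len₂ ⟩
  A ʳ++ redʳ c₂
    ≡⟨ cong (A ʳ++_) (redʳ-kept-pairs τ α c₁ le) ⟩
  A ʳ++ (pairs α τ ʳ++ redʳ c₁)
    ≡⟨ cong (λ r → A ʳ++ (pairs α τ ʳ++ r)) (red-gap {β = β} rem≡ len≡ u g cond) ⟩
  A ʳ++ (pairs α τ ʳ++ redʳ c)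
    ≡⟨ ++-ʳ++ (pairs α τ) ⟨
  (pairs α τ ++ A) ʳ++ redʳ c ∎
  where
  open ≡-Reasoning
  c₁ = pairs u g ʳ++ c
  c₂ = pairs α τ ʳ++ c₁
  rem₁ : length (remʳ c₁) ≡ 2 * (σ + g)
  rem₁ = rem-gap {β = β} rem≡ len≡ u g cond
  len₁ : length c₁ ≡ 2 * (β + σ + g)
  len₁ = length-pairs-ʳ++ u g c {β + σ} len≡
  len₂ : length c₂ ≡ 2 * (β + τ + (σ + g))
  len₂ = trans (length-pairs-ʳ++ α τ c₁ {β + σ + g} len₁) (lemma β σ g τ)
    where
    lemma : ∀ β σ g τ → 2 * (β + σ + g + τ) ≡ 2 * (β + τ + (σ + g))
    lemma = solve-∀
  -- `open′` is the failure of the removal test at the last pair of the block, u = α + τ - 1 with β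
  -- + τ - 1 kept pairs before it. There the test comes closest to succeeding, so the whole block is
  -- kept.
  le : 2 * length c₁ + 2 * τ ≤ suc (2 * α + length (remʳ c₁))
  le rewrite len₁ | rem₁ = ≤-by 1 (*-monoʳ-≤ 2 open′) (lemma β σ g τ α)
    where
    lemma : ∀ β σ g τ α → 2 * (2 * (β + σ + g)) + 2 * τ + 2 * α + 1
                        ≡ suc (2 * α + 2 * (σ + g)) + 2 * (2 * β + (σ + g) + τ)
    lemma = solve-∀

Layout⇒red : ∀ {n m T A} → Layout n m 0 0 0 T A → red T ≡ A
Layout⇒red {T = T} {A} lay = begin
  red T                       ≡⟨ red≡redʳ (Linked⇒AllPairs <-trans (Linked.tail (Linked-Layout lay))) ⟩
  reverse (redʳ (reverse T))  ≡⟨ cong reverse (redʳ-Layout lay [] refl refl) ⟩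
  reverse (reverse A)         ≡⟨ reverse-involutive A ⟩
  A                           ∎
  where
  open ≡-Reasoning

-- The interval lengths in halves

minimum : ∀ {k} → Vector ℕ k → ℕ → ℕ
minimum γ δ = foldr _⊓_ δ γ

-- The partial sums telescope: σ plus the current length is the current minimum, which is passed on
-- as the next σ. The final entry, with no γ left, is δ ∸ σ, half of the last length.
gaps : ∀ {k} → Vector ℕ k → ℕ → ℕ → Vector ℕ (suc k)
gaps         γ δ σ zero    = minimum γ δ ∸ σ
gaps {suc k} γ δ σ (suc i) = gaps (tail γ) δ (minimum γ δ) i

minimum-tail : ∀ {k} (γ : Vector ℕ (suc k)) δ → minimum γ δ ≤ minimum (tail γ) δ
minimum-tail γ δ = m⊓n≤n (γ zero) _

double-∸ : ∀ {m n} → n ≤ m → + (2 * m) ℤ.- + (2 * n) ≡ + (2 * (m ∸ n))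
double-∸ {m} {n} n≤m = begin
  + (2 * m) ℤ.- + (2 * n)  ≡⟨ ℤ.m-n≡m⊖n (2 * m) (2 * n) ⟩
  2 * m ℤ.⊖ 2 * n          ≡⟨ ℤ.⊖-≥ (*-monoʳ-≤ 2 n≤m) ⟩
  + (2 * m ∸ 2 * n)        ≡⟨ cong +_ (*-distribˡ-∸ 2 m n) ⟨
  + (2 * (m ∸ n))          ∎
  where open ≡-Reasoning

module _ (δ : ℕ) where

  -- Since σ is at most every term of the minimum, truncated subtraction is exact; doubling and
  -- subtracting then pass through the minimum.
  minLength-double : ∀ {k} (c : Vector ℤ k) γ σ → (∀ i → c i ≡ + (2 * γ i)) → σ ≤ minimum γ δ →
                     minLength c (+ (2 * δ)) (+ (2 * σ)) ≡ + (2 * (minimum γ δ ∸ σ))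
  minLength-double {zero}  c γ σ c≡ σ≤ = double-∸ σ≤
  minLength-double {suc k} c γ σ c≡ σ≤ = begin
    (c zero ℤ.- + (2 * σ)) ℤ.⊓ minLength (tail c) (+ (2 * δ)) (+ (2 * σ))
      ≡⟨ cong₂ ℤ._⊓_ (trans (cong (ℤ._- + (2 * σ)) (c≡ zero)) (double-∸ (≤-trans σ≤ (m⊓n≤m (γ zero) _))))
                     (minLength-double (tail c) (tail γ) σ (c≡ ∘ suc) (≤-trans σ≤ (minimum-tail γ δ))) ⟩
    + ((2 * (γ zero ∸ σ)) ⊓ (2 * (minimum (tail γ) δ ∸ σ)))
      ≡⟨ cong +_ (*-distribˡ-⊓ 2 (γ zero ∸ σ) _) ⟨
    + (2 * ((γ zero ∸ σ) ⊓ (minimum (tail γ) δ ∸ σ)))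
      ≡⟨ cong (λ x → + (2 * x)) (∸-distribʳ-⊓ σ (γ zero) _) ⟨
    + (2 * (minimum γ δ ∸ σ)) ∎
    where open ≡-Reasoning

  next-sum : ∀ {k} (c : Vector ℤ k) γ σ → (∀ i → c i ≡ + (2 * γ i)) → σ ≤ minimum γ δ →
             + (2 * σ) ℤ.+ minLength c (+ (2 * δ)) (+ (2 * σ)) ≡ + (2 * minimum γ δ)
  next-sum c γ σ c≡ σ≤ = trans (cong (λ x → + (2 * σ) ℤ.+ x) (minLength-double c γ σ c≡ σ≤))
    (cong +_ (trans (sym (*-distribˡ-+ 2 σ _)) (cong (2 *_) (m+[n∸m]≡n σ≤))))

  lengthsFrom-double : ∀ {k} (c : Vector ℤ k) γ σ → (∀ i → c i ≡ + (2 * γ i)) → σ ≤ minimum γ δ →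
                       ∀ i → lengthsFrom c (+ (2 * δ)) (+ (2 * σ)) i ≡ + (2 * gaps γ δ σ (inject₁ i))
  lengthsFrom-double c γ σ c≡ σ≤ zero    = minLength-double c γ σ c≡ σ≤
  lengthsFrom-double c γ σ c≡ σ≤ (suc i) =
    trans (cong (λ s → lengthsFrom (tail c) (+ (2 * δ)) s i) (next-sum c γ σ c≡ σ≤))
          (lengthsFrom-double (tail c) (tail γ) (minimum γ δ) (c≡ ∘ suc) (minimum-tail γ δ) i)

  lastLength-double : ∀ {k} (c : Vector ℤ k) γ σ → (∀ i → c i ≡ + (2 * γ i)) → σ ≤ minimum γ δ →
                      + (2 * δ) ℤ.- + (2 * σ) ℤ.- sumℤ (lengthsFrom c (+ (2 * δ)) (+ (2 * σ)))
                      ≡ + (2 * gaps γ δ σ (fromℕ k))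
  lastLength-double {zero}  c γ σ c≡ σ≤ = trans (ℤ.+-identityʳ _) (double-∸ σ≤)
  lastLength-double {suc k} c γ σ c≡ σ≤ = begin
    d ℤ.- s ℤ.- (g ℤ.+ sumℤ (lengthsFrom (tail c) d (s ℤ.+ g)))
      ≡⟨ lemma d s g _ ⟩
    d ℤ.- (s ℤ.+ g) ℤ.- sumℤ (lengthsFrom (tail c) d (s ℤ.+ g))
      ≡⟨ cong (λ s → d ℤ.- s ℤ.- sumℤ (lengthsFrom (tail c) d s)) (next-sum c γ σ c≡ σ≤) ⟩
    d ℤ.- + (2 * minimum γ δ) ℤ.- sumℤ (lengthsFrom (tail c) d (+ (2 * minimum γ δ)))
      ≡⟨ lastLength-double (tail c) (tail γ) (minimum γ δ) (c≡ ∘ suc) (minimum-tail γ δ) ⟩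
    + (2 * gaps γ δ σ (fromℕ (suc k))) ∎
    where
    open ≡-Reasoning
    d = + (2 * δ)
    s = + (2 * σ)
    g = minLength c d s
    lemma : ∀ d s g r → d ℤ.- s ℤ.- (g ℤ.+ r) ≡ d ℤ.- (s ℤ.+ g) ℤ.- r
    lemma = ℤ-Solver.solve-∀

insertAt-fromℕ : ∀ {A : Set} {k} (xs : Vector A k) v (ys : Vector A (suc k)) →
                 (∀ i → xs i ≡ ys (inject₁ i)) → v ≡ ys (fromℕ k) →
                 ∀ j → insertAt xs (fromℕ k) v j ≡ ys j
insertAt-fromℕ {k = zero}  xs v ys eq eqᵥ zero    = eqᵥ
insertAt-fromℕ {k = suc k} xs v ys eq eqᵥ zero    = eq zero
insertAt-fromℕ {k = suc k} xs v ys eq eqᵥ (suc j) = insertAt-fromℕ (tail xs) v (tail ys) (eq ∘ suc) eqᵥ j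

-- Lower bounds for the aᵢ

-- The offset β counts the entries in front of `xs`, so that blocks can be split off one after
-- another.
Symplectic : ℕ → List ℕ → Set
Symplectic β xs = ∀ (i : Fin (length xs)) → 2 * (β + toℕ i) + 1 ≤ lookup xs i

Symplectic-tail : ∀ β x xs → Symplectic β (x ∷ xs) → Symplectic (suc β) xs
Symplectic-tail β x xs sp i = subst (λ b → 2 * b + 1 ≤ lookup xs i) (+-suc β (toℕ i)) (sp (suc i))

Symplectic-++ʳ : ∀ β xs ys → Symplectic β (xs ++ ys) → Symplectic (β + length xs) ys
Symplectic-++ʳ β []       ys sp = subst (λ b → Symplectic b ys) (sym (+-identityʳ β)) sp
Symplectic-++ʳ β (x ∷ xs) ys sp = subst (λ b → Symplectic b ys) (sym (+-suc β (length xs)))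
  (Symplectic-++ʳ (suc β) xs ys (Symplectic-tail β x (xs ++ ys) sp))

Symplectic-applyUpTo : ∀ β f m ys → Symplectic β (applyUpTo f (suc m) ++ ys) → 2 * (β + m) + 1 ≤ f m
Symplectic-applyUpTo β f zero    ys sp = sp zero
Symplectic-applyUpTo β f (suc m) ys sp =
  subst (λ b → 2 * b + 1 ≤ f (suc m)) (sym (+-suc β m))
    (Symplectic-applyUpTo (suc β) (f ∘ suc) m ys (Symplectic-tail β (f 0) _ sp))

-- The symplectic condition at the last entry of a block gives 2 (β + t - 1) + 1 ≤ a + t - 1, that
-- is, 2β + t ≤ a, where β entries precede the block. The left side is even and a is odd, hence the
-- extra 1.
a-lower-bound : ∀ {k} β (a t : Vector ℕ k) → (∀ i → ¬ (2 ∣ a i)) → (∀ i → 2 ∣ t i) → (∀ i → 2 ≤ t i) →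
                Symplectic β (⨁ a t) → ∀ i → 2 * (β + sumBefore t i) + t i + 1 ≤ a i
a-lower-bound β a t a-odd t-even t≥2 sp zero with t zero | a-odd zero | t-even zero | t≥2 zero | sp
... | suc m | odd₀ | even₀ | _ | sp₀ = subst (_≤ a zero) (+-comm 1 _) (≤∧≢⇒< le neq)
  where
  le : 2 * (β + 0) + suc m ≤ a zero
  le = ≤-by 0 (Symplectic-applyUpTo β (λ j → a zero + j) m _ sp₀) (lemma β m (a zero))
    where
    lemma : ∀ β m x → 2 * (β + 0) + suc m + (x + m) + 0 ≡ x + (2 * (β + m) + 1)
    lemma = solve-∀
  neq : 2 * (β + 0) + suc m ≢ a zero
  neq eq = odd₀ (subst (2 ∣_) eq (∣m∣n⇒∣m+n (m∣m*n (β + 0)) even₀))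
a-lower-bound β a t a-odd t-even t≥2 sp (suc i) =
  subst (λ b → 2 * b + t (suc i) + 1 ≤ a (suc i)) (+-assoc β (t zero) _)
    (a-lower-bound (β + t zero) (tail a) (tail t) (a-odd ∘ suc) (t-even ∘ suc) (t≥2 ∘ suc)
      (subst (λ m → Symplectic (β + m) (⨁ (tail a) (tail t))) (length-applyUpTo (λ j → a zero + j) (t zero))
        (Symplectic-++ʳ β (interval (a zero) (t zero)) _ sp)) i)

-- Read off at the last entry a + t - 1 of the block, which exists because the block is nonempty.
⨁-bound : ∀ {k m} (a t : Vector ℕ k) → (∀ i → 2 ≤ t i) → All (_≤ m) (⨁ a t) → ∀ i → a i + t i ≤ suc m
⨁-bound {m = m} a t t≥2 as zero with t zero | t≥2 zero | as
... | suc r | _ | as₀ =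
  subst (_≤ suc m) (sym (+-suc (a zero) r))
    (s≤s (All.applyUpTo⁻ (λ j → a zero + j) (suc r) (All.++⁻ˡ (interval (a zero) (suc r)) as₀) ≤-refl))
⨁-bound a t t≥2 as (suc i) = ⨁-bound (tail a) (tail t) (t≥2 ∘ suc) (All.++⁻ʳ (interval (a zero) (t zero)) as) i

-- The layout of the preimage

intervalℤ-pairs : ∀ {q z} u g → q ≡ 1 + 2 * u → z ≡ + (2 * g) → intervalℤ q z ≡ pairs u g
intervalℤ-pairs u g refl refl = interval-pairs u g

-- Here π = u - 2β is half the slack of the block just passed (0 at the start), so the removal test
-- u ≤ 2β + σ amounts to π ≤ σ. Otherwise M ∸ σ, the size of the next gap, vanishes.
removable-or-empty : ∀ β {π σ M} → π ≤ σ ⊎ M ≤ σ → M ∸ σ ≡ 0 ⊎ 2 * β + π ≤ 2 * β + σ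
removable-or-empty β (inj₁ π≤σ) = inj₂ (+-monoʳ-≤ (2 * β) π≤σ)
removable-or-empty β (inj₂ M≤σ) = inj₁ (m≤n⇒m∸n≡0 M≤σ)

-- Induction over the blocks. The invariant `π ≤ σ ⊎ minimum γ δ ≤ σ` records that the next gap is
-- removed or empty; that the minimum is at most γ of the next block keeps this block.
preimage-Layout :
  ∀ {n m k} (a t α τ γ : Vector ℕ k) (len : Vector ℤ (suc k)) u β σ π δ →
  (∀ i → a i ≡ 1 + 2 * α i) → (∀ i → t i ≡ 2 * τ i) → (∀ i → len i ≡ + (2 * gaps γ δ σ i)) →
  (∀ i → α i ≡ 2 * (β + sumBefore τ i) + τ i + γ i) →
  u ≡ 2 * β + π → π ≤ σ ⊎ minimum γ δ ≤ σ → σ ≤ minimum γ δ →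
  u ≤ n → (∀ i → α i + τ i ≤ n) → β + sumℕ τ + δ ≡ m → m + (β + sumℕ τ) ≤ n →
  (∀ i → toℕ i ≡ 0 → u ≤ α i) → (∀ i j → toℕ j ≡ suc (toℕ i) → α i + τ i ≤ α j) →
  Layout n m u β σ
    (intervalℤ (1 + 2 * u) (len zero)
      ++ concat (tabulate (λ i → interval (a i) (t i) ++ intervalℤ (a i + t i) (len (suc i)))))
    (⨁ a t)
preimage-Layout {n} {m} {zero} a t α τ γ len u β σ π δ a≡ t≡ len≡ α≡ refl cond σ≤δ u≤n _ m≡ m≤ _ _ =
  subst (λ T → Layout n m u β σ T []) (sym (trans (++-identityʳ _) (intervalℤ-pairs u g refl (len≡ zero))))
    (end g gap-cond bound (trans (+-assoc β σ g) (trans (cong (λ x → β + x) (m+[n∸m]≡n σ≤δ)) m≡′)))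
  where
  g = δ ∸ σ
  m≡′ : β + δ ≡ m
  m≡′ = trans (cong (_+ δ) (sym (+-identityʳ β))) m≡
  gap-cond : g ≡ 0 ⊎ 2 * β + π ≤ 2 * β + σ
  gap-cond = removable-or-empty β cond
  -- A nonempty last gap may reach up to 2β + δ = m + β. That this is at most n is the hypothesis t
  -- ≤ 2n - l in halves.
  bound : 2 * β + π + g ≤ n
  bound with gap-cond
  ... | inj₁ g≡0 = subst (λ g → 2 * β + π + g ≤ n) (sym g≡0) (subst (_≤ n) (sym (+-identityʳ _)) u≤n)
  ... | inj₂ u≤  = begin
    2 * β + π + g      ≤⟨ +-monoˡ-≤ g u≤ ⟩
    2 * β + σ + g      ≡⟨ +-assoc (2 * β) σ g ⟩
    2 * β + (σ + g)    ≡⟨ cong (λ x → 2 * β + x) (m+[n∸m]≡n σ≤δ) ⟩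
    2 * β + δ          ≡⟨ lemma β δ ⟩
    β + δ + (β + 0)    ≡⟨ cong (_+ (β + 0)) m≡′ ⟩
    m + (β + 0)        ≤⟨ m≤ ⟩
    n                  ∎
    where
    open ≤-Reasoning
    lemma : ∀ β δ → 2 * β + δ ≡ β + δ + (β + 0)
    lemma = solve-∀
preimage-Layout {n} {m} {suc k} a t α τ γ len u β σ π δ a≡ t≡ len≡ α≡ refl cond σ≤M u≤n α≤n m≡ m≤ u≤α gap =
  subst₂ (Layout n m u β σ) (sym T≡) (sym A≡)
    (block g gap-cond bound open′
      (subst (λ s → Layout n m (α₀ + τ₀) (β + τ₀) s T (⨁ (tail a) (tail t))) (sym (m+[n∸m]≡n σ≤M))
        (preimage-Layout (tail a) (tail t) (tail α) (tail τ) (tail γ) (tail len)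
          (α₀ + τ₀) (β + τ₀) M γ₀ δ
          (a≡ ∘ suc) (t≡ ∘ suc) (len≡ ∘ suc)
          (λ i → trans (α≡ (suc i)) (cong (λ b → 2 * b + τ (suc i) + γ (suc i)) (sym (+-assoc β τ₀ _))))
          (trans (cong (_+ τ₀) (α≡ zero)) (lemma₁ β τ₀ γ₀))
          next-cond (minimum-tail γ δ)
          (α≤n zero) (α≤n ∘ suc)
          (trans (cong (_+ δ) (+-assoc β τ₀ _)) m≡)
          (subst (λ b → m + b ≤ n) (sym (+-assoc β τ₀ _)) m≤)
          (λ j j≡0 → gap zero (suc j) (cong suc j≡0))
          (λ i j eq → gap (suc i) (suc j) (cong suc eq)))))
  where
  α₀ = α zero
  τ₀ = τ zero
  γ₀ = γ zero
  M  = minimum γ δ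
  g  = M ∸ σ
  rest = concat (tabulate (λ i → interval (a (suc i)) (t (suc i)) ++ intervalℤ (a (suc i) + t (suc i)) (len (suc (suc i)))))
  T  = intervalℤ (1 + 2 * (α₀ + τ₀)) (len (suc zero)) ++ rest
  lemma₁ : ∀ β τ γ → 2 * (β + 0) + τ + γ + τ ≡ 2 * (β + τ) + γ
  lemma₁ = solve-∀
  lemma₂ : ∀ β τ γ → 2 * β + γ + τ ≡ 2 * (β + 0) + τ + γ
  lemma₂ = solve-∀
  block≡ : interval (a zero) (t zero) ≡ pairs α₀ τ₀
  block≡ = trans (cong₂ interval (a≡ zero) (t≡ zero)) (interval-pairs α₀ τ₀)
  next≡ : a zero + t zero ≡ 1 + 2 * (α₀ + τ₀)
  next≡ = trans (cong₂ _+_ (a≡ zero) (t≡ zero)) (cong suc (sym (*-distribˡ-+ 2 α₀ τ₀)))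
  A≡ : ⨁ a t ≡ pairs α₀ τ₀ ++ ⨁ (tail a) (tail t)
  A≡ = cong (_++ ⨁ (tail a) (tail t)) block≡
  T≡ : intervalℤ (1 + 2 * u) (len zero)
       ++ ((interval (a zero) (t zero) ++ intervalℤ (a zero + t zero) (len (suc zero))) ++ rest)
       ≡ pairs u g ++ (pairs α₀ τ₀ ++ T)
  T≡ = cong₂ _++_ (intervalℤ-pairs u g refl (len≡ zero))
         (trans (++-assoc (interval (a zero) (t zero)) _ rest)
           (cong₂ _++_ block≡ (cong (λ q → intervalℤ q (len (suc zero)) ++ rest) next≡)))
  gap-cond : g ≡ 0 ⊎ 2 * β + π ≤ 2 * β + σ
  gap-cond = removable-or-empty β cond
  open′ : 2 * β + (σ + g) + τ₀ ≤ α₀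
  open′ = begin
    2 * β + (σ + g) + τ₀      ≡⟨ cong (λ s → 2 * β + s + τ₀) (m+[n∸m]≡n σ≤M) ⟩
    2 * β + M + τ₀            ≤⟨ +-monoˡ-≤ τ₀ (+-monoʳ-≤ (2 * β) (m⊓n≤m γ₀ _)) ⟩
    2 * β + γ₀ + τ₀           ≡⟨ lemma₂ β τ₀ γ₀ ⟩
    2 * (β + 0) + τ₀ + γ₀     ≡⟨ α≡ zero ⟨
    α₀                        ∎
    where open ≤-Reasoning
  bound : 2 * β + π + g ≤ α₀
  bound with gap-cond
  ... | inj₁ g≡0 = subst (λ g → 2 * β + π + g ≤ α₀) (sym g≡0) (subst (_≤ α₀) (sym (+-identityʳ _)) (u≤α zero refl))
  ... | inj₂ u≤  = begin
    2 * β + π + g         ≤⟨ +-monoˡ-≤ g u≤ ⟩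
    2 * β + σ + g         ≡⟨ +-assoc (2 * β) σ g ⟩
    2 * β + (σ + g)       ≤⟨ m≤m+n _ τ₀ ⟩
    2 * β + (σ + g) + τ₀  ≤⟨ open′ ⟩
    α₀                    ∎
    where open ≤-Reasoning
  -- The minimum is attained either at this block, and then the pairs after it pass the test, or
  -- later, and then the next minimum is no larger and the gap is empty.
  next-cond : γ₀ ≤ M ⊎ minimum (tail γ) δ ≤ M
  next-cond with ⊓-sel γ₀ (minimum (tail γ) δ)
  ... | inj₁ eq = inj₁ (≤-reflexive (sym eq))
  ... | inj₂ eq = inj₂ (≤-reflexive (sym eq))

-- Halving the given data, and the theorem

odd-half : ∀ m → ¬ (2 ∣ m) → ∃[ h ] m ≡ 1 + 2 * h
odd-half zero          m-odd = contradiction (divides 0 refl) m-odd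
odd-half (suc zero)    m-odd = 0 , refl
odd-half (suc (suc m)) m-odd with odd-half m (λ 2∣m → m-odd (∣m∣n⇒∣m+n (divides 1 refl) 2∣m))
... | h , refl = suc h , cong suc (sym (2*suc h))

even-half : ∀ {m} → 2 ∣ m → ∃[ h ] m ≡ 2 * h
even-half (divides h eq) = h , trans eq (*-comm h 2)

sumℕ-double : ∀ {k} (t τ : Vector ℕ k) → (∀ i → t i ≡ 2 * τ i) → sumℕ t ≡ 2 * sumℕ τ
sumℕ-double {zero}  t τ t≡ = refl
sumℕ-double {suc k} t τ t≡ =
  trans (cong₂ _+_ (t≡ zero) (sumℕ-double (tail t) (tail τ) (t≡ ∘ suc))) (sym (*-distribˡ-+ 2 (τ zero) _))

slack-double : ∀ {k} (a t γ : Vector ℕ k) i → a i ≡ 2 * γ i + (1 + (t i + 2 * sumBefore t i)) →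
               slack a t i ≡ + (2 * γ i)
slack-double a t γ i a≡ =
  trans (cong (λ x → + x ℤ.- + (2 * sumBefore t i) ℤ.- + t i ℤ.- 1ℤ) a≡)
        (lemma (+ (2 * γ i)) (+ t i) (+ (2 * sumBefore t i)))
  where
  lemma : ∀ x y z → (x ℤ.+ (1ℤ ℤ.+ (y ℤ.+ z))) ℤ.- z ℤ.- y ℤ.- 1ℤ ≡ x
  lemma = ℤ-Solver.solve-∀

double-nonneg-even : ∀ {z} g → z ≡ + (2 * g) → 0ℤ ℤ.≤ z × + 2 ℤ.∣ z
double-nonneg-even g refl = ℤ.+≤+ z≤n , m∣m*n g

theorem6 : ∀ (n k l : ℕ) → 1 ≤ n → 1 ≤ k → l ≤ 2 * n →
    ∀ (a t : Vector ℕ k) →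
    1 ≤ sumℕ t → sumℕ t ≤ n →
    2 ≤ sumℕ t → sumℕ t ≤ l ⊓ (2 * n ∸ l) →
    2 ∣ l ∸ sumℕ t →
    Separated a t →
    SpT n (sumℕ t) (⨁ a t) →
    (∀ i → 2 * sumBefore t i + t i + 1 ≤ a i)
    × (∀ i → 0ℤ ℤ.≤ gapLengths l a t i × + 2 ℤ.∣ gapLengths l a t i)
    × (0ℤ ℤ.≤ lastLength l a t × + 2 ℤ.∣ lastLength l a t)
    × SST n l (preimage l a t)
    × red (preimage l a t) ≡ ⨁ a t
    × (∀ (b : List ℕ) → SST n l b → red b ≡ ⨁ a t → b ≡ preimage l a t)
theorem6 n k l _ _ l≤2n a t _ _ _ t≤ l-t-even sep spt =
  a≥
  , (λ i → double-nonneg-even (gaps γ δ 0 (inject₁ i)) (gap≡ i))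
  , double-nonneg-even (gaps γ δ 0 (fromℕ k)) last≡
  , sst
  , red≡
  , (λ b sst-b red-b → red-injective sst-b sst (trans red-b (sym red≡)))
  where
  open Separated sep
  open SpT spt
  τ α γ : Vector ℕ k
  τ i = proj₁ (even-half (t-even i))
  α i = proj₁ (odd-half (a i) (a-odd i))
  γ i = α i ∸ (2 * sumBefore τ i + τ i)
  δ m : ℕ
  δ = proj₁ (even-half l-t-even)
  m = sumℕ τ + δ

  t≡ : ∀ i → t i ≡ 2 * τ i
  t≡ i = proj₂ (even-half (t-even i))
  a≡ : ∀ i → a i ≡ 1 + 2 * α i
  a≡ i = proj₂ (odd-half (a i) (a-odd i))

  a≥ : ∀ i → 2 * sumBefore t i + t i + 1 ≤ a i
  a≥ = a-lower-bound 0 a t a-odd t-even t-positive symplectic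

  before≡ : ∀ i → sumBefore t i ≡ 2 * sumBefore τ i
  before≡ i = sumℕ-double {toℕ i} _ (λ m → τ (inject m)) (λ m → t≡ (inject m))

  -- The lower bound `a≥`, halved, makes the truncated subtraction in `γ` exact.
  α≡ : ∀ i → α i ≡ 2 * sumBefore τ i + τ i + γ i
  α≡ i = sym (m+[n∸m]≡n {2 * sumBefore τ i + τ i} (*-cancelˡ-≤ 2 (≤-by 0 le (lemma (sumBefore τ i) (τ i) (α i)))))
    where
    le : 2 * (2 * sumBefore τ i) + 2 * τ i + 1 ≤ 1 + 2 * α i
    le = subst₂ _≤_ (cong₂ (λ x y → 2 * x + y + 1) (before≡ i) (t≡ i)) (a≡ i) (a≥ i)
    lemma : ∀ s t x → 2 * (2 * s + t) + (1 + 2 * x) + 0 ≡ 2 * x + (2 * (2 * s) + 2 * t + 1)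
    lemma = solve-∀

  slack≡ : ∀ i → slack a t i ≡ + (2 * γ i)
  slack≡ i = slack-double a t γ i (begin
    a i                                                     ≡⟨ a≡ i ⟩
    1 + 2 * α i                                             ≡⟨ cong (λ x → 1 + 2 * x) (α≡ i) ⟩
    1 + 2 * (2 * sumBefore τ i + τ i + γ i)                 ≡⟨ lemma (sumBefore τ i) (τ i) (γ i) ⟩
    2 * γ i + (1 + (2 * τ i + 2 * (2 * sumBefore τ i)))     ≡⟨ cong₂ (λ x y → 2 * γ i + (1 + (x + 2 * y))) (t≡ i) (before≡ i) ⟨
    2 * γ i + (1 + (t i + 2 * sumBefore t i))               ∎)
    where
    open ≡-Reasoning
    lemma : ∀ s t g → 1 + 2 * (2 * s + t + g) ≡ 2 * g + (1 + (2 * t + 2 * (2 * s)))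
    lemma = solve-∀

  t≤l : sumℕ t ≤ l
  t≤l = m≤n⊓o⇒m≤n l _ t≤

  l≡ : l ≡ 2 * m
  l≡ = begin
    l                        ≡⟨ m+[n∸m]≡n t≤l ⟨
    sumℕ t + (l ∸ sumℕ t)    ≡⟨ cong₂ _+_ (sumℕ-double t τ t≡) (proj₂ (even-half l-t-even)) ⟩
    2 * sumℕ τ + 2 * δ       ≡⟨ *-distribˡ-+ 2 (sumℕ τ) δ ⟨
    2 * m                    ∎
    where open ≡-Reasoning

  d≡ : + l ℤ.- + sumℕ t ≡ + (2 * δ)
  d≡ = trans (ℤ.m-n≡m⊖n l (sumℕ t)) (trans (ℤ.⊖-≥ t≤l) (cong +_ (proj₂ (even-half l-t-even))))

  gap≡ : ∀ i → gapLengths l a t i ≡ + (2 * gaps γ δ 0 (inject₁ i))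
  gap≡ i = trans (cong (λ d → lengthsFrom (slack a t) d 0ℤ i) d≡)
                 (lengthsFrom-double δ (slack a t) γ 0 slack≡ z≤n i)

  last≡ : lastLength l a t ≡ + (2 * gaps γ δ 0 (fromℕ k))
  last≡ = trans (cong (λ d → d ℤ.- sumℤ (lengthsFrom (slack a t) d 0ℤ)) d≡)
    -- A term - 0 is inserted, the initial partial sum σ = 0 of `lastLength-double`.
    (trans (cong (ℤ._- sumℤ (lengthsFrom (slack a t) (+ (2 * δ)) 0ℤ)) (sym (ℤ.+-identityʳ (+ (2 * δ)))))
      (lastLength-double δ (slack a t) γ 0 slack≡ z≤n))

  m+τ≤n : m + sumℕ τ ≤ n
  m+τ≤n = *-cancelˡ-≤ 2 (begin
    2 * (m + sumℕ τ)      ≡⟨ *-distribˡ-+ 2 m (sumℕ τ) ⟩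
    2 * m + 2 * sumℕ τ    ≡⟨ cong₂ _+_ l≡ (sumℕ-double t τ t≡) ⟨
    l + sumℕ t            ≤⟨ +-monoʳ-≤ l (m≤n⊓o⇒m≤o l _ t≤) ⟩
    l + (2 * n ∸ l)       ≡⟨ m+[n∸m]≡n l≤2n ⟩
    2 * n                 ∎)
    where open ≤-Reasoning

  α+τ≤n : ∀ i → α i + τ i ≤ n
  α+τ≤n i = *-cancelˡ-≤ 2 (subst (_≤ 2 * n) (sym (*-distribˡ-+ 2 (α i) (τ i)))
    (≤-pred (subst (_≤ suc (2 * n)) (cong₂ _+_ (a≡ i) (t≡ i))
      (⨁-bound a t t-positive (All.map proj₂ (SST.entries column)) i))))

  gap-half : ∀ i j → toℕ j ≡ suc (toℕ i) → α i + τ i ≤ α j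
  gap-half i j eq = *-cancelˡ-≤ 2 (≤-by 2
    (subst₂ _≤_ (cong₂ (λ x y → x + (y + 2)) (a≡ i) (t≡ i)) (a≡ j) (gap i j eq)) (lemma (α i) (τ i) (α j)))
    where
    lemma : ∀ x y z → 2 * (x + y) + (1 + 2 * z) + 2 ≡ 2 * z + (1 + 2 * x + (2 * y + 2))
    lemma = solve-∀

  layout : Layout n m 0 0 0 (preimage l a t) (⨁ a t)
  -- Nothing precedes the first gap, so u, β, σ and π all start at 0, and π ≤ σ holds.
  layout = preimage-Layout a t α τ γ _ 0 0 0 0 δ a≡ t≡
    (insertAt-fromℕ (gapLengths l a t) (lastLength l a t) (λ i → + (2 * gaps γ δ 0 i)) gap≡ last≡)
    α≡ refl (inj₁ z≤n) z≤n z≤n α+τ≤n refl m+τ≤n (λ _ _ → z≤n) gap-half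

  sst : SST n l (preimage l a t)
  sst = subst (λ l′ → SST n l′ (preimage l a t)) (sym l≡) (Layout⇒SST layout)

  red≡ : red (preimage l a t) ≡ ⨁ a t
  red≡ = Layout⇒red layout
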